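{- Let $q$ be a prime power, let $m\ge 1$, $n\ge 2$ be integers, let $h$ be an integer with $1\le h\le m$, and let $X$ be a vector space of dimension $n$ over $\mathbb{F}_{q^m}$, regarded as an $mn$-dimensional vector space over $\mathbb{F}_q$. There exists a partial Desarguesian $m$-spread $\mathcal{A}$ of $X$ of size $|\mathcal{A}|=q^{m(n-1)}$ for which there exists an $(\mathcal{A},h)$-evasive $\mathbb{F}_q$-subspace of $X$ of dimension $m(n-1)+h$ over $\mathbb{F}_q$.
   Context: A collection $\mathcal{A}$ of $m$-dimensional $\mathbb{F}_q$-subspaces of $X$ is a partial $m$-spread if $S\cap S'=\{0\}$ for all distinct $S,S'\in\mathcal{A}$; it is an $m$-spread if moreover every non-zero vector of $X$ lies in exactly one element of $\mathcal{A}$. Let $\mathcal{D}=\{\langle x\rangle_{\mathbb{F}_{q^m}} : x\in X\setminus\{0\}\}$, which is an $m$-spread of $X$. An $m$-spread of $X$ is Desarguesian if it is the image of $\mathcal{D}$ under an invertible $\mathbb{F}_q$-semilinear map of $X$ (an element of $\Gamma\mathrm{L}(nm,q)$); a partial $m$-spread is called partial Desarguesian if it is contained in a Desarguesian $m$-spread. An $\mathbb{F}_q$-subspace $U\le X$ is $(\mathcal{A},h)$-evasive if $\dim_{\mathbb{F}_q}(U\cap S)\leq h$ for all $S\in\mathcal{A}$. -}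

module Defs where

open import Level using (Level; _⊔_) renaming (suc to lsuc)
open import Data.Nat.Base using (ℕ; _^_; _≤_)
open import Data.Nat.Primality using (Prime)
open import Data.Fin.Base using (Fin)
open import Data.Product using (∃-syntax; ∃!; _×_; proj₁)
open import Relation.Nullary.Negation using (¬_)
open import Relation.Unary using (Pred; _∈_; _∩_; _≐_)
open import Relation.Unary.Relation.Binary.Equality using (≐-setoid)
open import Relation.Binary.Bundles using (Setoid)
open import Relation.Binary.Core using (Rel)
open import Relation.Binary.Definitions using (_Respects_)
import Relation.Binary.Construct.On as On
import Relation.Binary.PropositionalEquality as ≡
open import Relation.Binary.PropositionalEquality using (_≡_)
open import Function.Bundles using (Bijection)
open import Algebra.Bundles using (Ring; CommutativeRing; CommutativeMonoid)
open import Algebra.Apartness.Bundles using (HeytingField; HeytingCommutativeRing)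
open import Algebra.Module.Bundles using (LeftModule)
open import Algebra.Morphism.Bundles using (RingHomomorphism)
open import Algebra.Morphism.Structures using (IsRingIsomorphism; IsGroupIsomorphism)
import Algebra.Definitions.RawMonoid as RawMonoidDefs

private
  variable
    a ℓ : Level

IsPrimePower : ℕ → Set
IsPrimePower q = ∃[ p ] ∃[ k ] Prime p × 1 ≤ k × q ≡ p ^ k

HasSize : Setoid a ℓ → ℕ → Set (a ⊔ ℓ)
HasSize S N = Bijection (≡.setoid (Fin N)) S

-- On a finite setoid the apartness of a Heyting field is forced to be the
-- negation of equality, so a Heyting field with finitely many elements is just
-- a finite field in the usual sense.

fieldRing : ∀ {c ℓ₁ ℓ₂} → HeytingField c ℓ₁ ℓ₂ → Ring c ℓ₁
fieldRing K = CommutativeRing.ring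
  (HeytingCommutativeRing.commutativeRing (HeytingField.heytingCommutativeRing K))

-- A ring homomorphism between fields is automatically injective, so it exhibits
-- its codomain as an extension of its domain.

FieldExtension : ∀ {c ℓ₁ ℓ₂ c′ ℓ₁′ ℓ₂′} →
                 HeytingField c ℓ₁ ℓ₂ → HeytingField c′ ℓ₁′ ℓ₂′ →
                 Set (c ⊔ ℓ₁ ⊔ c′ ⊔ ℓ₁′)
FieldExtension F K =
  RingHomomorphism (Ring.rawRing (fieldRing F)) (Ring.rawRing (fieldRing K))

module _ {r ℓr s ℓs m ℓm : Level} {R : Ring r ℓr} {S : Ring s ℓs} where

  restrictScalars : RingHomomorphism (Ring.rawRing R) (Ring.rawRing S) →
                    LeftModule S m ℓm → LeftModule R m ℓm
  restrictScalars ι M = record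
    { Carrierᴹ     = Carrierᴹ
    ; _≈ᴹ_         = _≈ᴹ_
    ; _+ᴹ_         = _+ᴹ_
    ; _*ₗ_         = λ c x → ⟦ c ⟧ *ₗ x
    ; 0ᴹ           = 0ᴹ
    ; -ᴹ_          = -ᴹ_
    ; isLeftModule = record
      { isLeftSemimodule = record
        { +ᴹ-isCommutativeMonoid = +ᴹ-isCommutativeMonoid
        ; isPreleftSemimodule    = record
          { *ₗ-cong      = λ c≈d x≈y → *ₗ-cong (⟦⟧-cong c≈d) x≈y
          ; *ₗ-zeroˡ     = λ x → ≈ᴹ-trans (*ₗ-congʳ 0#-homo) (*ₗ-zeroˡ x)
          ; *ₗ-distribʳ  = λ x c d →
              ≈ᴹ-trans (*ₗ-congʳ (+-homo c d)) (*ₗ-distribʳ x ⟦ c ⟧ ⟦ d ⟧)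
          ; *ₗ-identityˡ = λ x → ≈ᴹ-trans (*ₗ-congʳ 1#-homo) (*ₗ-identityˡ x)
          ; *ₗ-assoc     = λ c d x →
              ≈ᴹ-trans (*ₗ-congʳ (*-homo c d)) (*ₗ-assoc ⟦ c ⟧ ⟦ d ⟧ x)
          ; *ₗ-zeroʳ     = λ c → *ₗ-zeroʳ ⟦ c ⟧
          ; *ₗ-distribˡ  = λ c → *ₗ-distribˡ ⟦ c ⟧
          }
        }
      ; -ᴹ‿cong    = -ᴹ‿cong
      ; -ᴹ‿inverse = -ᴹ‿inverse
      }
    }
    where
    open LeftModule M
    open RingHomomorphism ι

module Linear {r ℓr m ℓm : Level} {R : Ring r ℓr} (M : LeftModule R m ℓm) where

  open Ring R using (0#) renaming (Carrier to Scalar; _≈_ to _≈ˢ_)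
  open LeftModule M
  open RawMonoidDefs (CommutativeMonoid.rawMonoid +ᴹ-commutativeMonoid) using (sum)

  combination : {d : ℕ} → (Fin d → Scalar) → (Fin d → Carrierᴹ) → Carrierᴹ
  combination c b = sum (λ i → c i *ₗ b i)

  record IsBasis {p : Level} {d : ℕ} (W : Pred Carrierᴹ p) (b : Fin d → Carrierᴹ) :
                 Set (r ⊔ ℓr ⊔ m ⊔ ℓm ⊔ p) where
    field
      members     : ∀ i → b i ∈ W
      independent : ∀ c → combination c b ≈ᴹ 0ᴹ → ∀ i → c i ≈ˢ 0#
      spanning    : ∀ x → x ∈ W → ∃[ c ] combination c b ≈ᴹ x

  HasDim : {p : Level} → Pred Carrierᴹ p → ℕ → Set (r ⊔ ℓr ⊔ m ⊔ ℓm ⊔ p)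
  HasDim W d = ∃[ b ] IsBasis {d = d} W b

  DimAtMost : {p : Level} → Pred Carrierᴹ p → ℕ → Set (r ⊔ ℓr ⊔ m ⊔ ℓm ⊔ p)
  DimAtMost W h = ∃[ d ] d ≤ h × HasDim W d

  record Subspace (p : Level) : Set (r ⊔ m ⊔ ℓm ⊔ lsuc p) where
    field
      set       : Pred Carrierᴹ p
      respects  : set Respects _≈ᴹ_
      0-closed  : 0ᴹ ∈ set
      +-closed  : ∀ {x y} → x ∈ set → y ∈ set → x +ᴹ y ∈ set
      *ₗ-closed : ∀ c {x} → x ∈ set → c *ₗ x ∈ set

  record InvertibleSemilinear : Set (r ⊔ ℓr ⊔ m ⊔ ℓm) where
    field
      σ                : Scalar → Scalar
      φ                : Carrierᴹ → Carrierᴹ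
      σ-isAutomorphism : IsRingIsomorphism (Ring.rawRing R) (Ring.rawRing R) σ
      φ-isGroupIso     : IsGroupIsomorphism +ᴹ-rawGroup +ᴹ-rawGroup φ
      φ-semilinear     : ∀ c x → φ (c *ₗ x) ≈ᴹ σ c *ₗ φ x

-- Collections of subspaces are predicates invariant under extensional equality
-- _≗_, so sizes and distinctness of members are always counted up to _≗_.

module Spreads {ℓ : Level} {F K : HeytingField ℓ ℓ ℓ} (ι : FieldExtension F K)
               (X : LeftModule (fieldRing K) ℓ ℓ) where

  open LeftModule X using (Carrierᴹ; _≈ᴹ_; _*ₗ_; 0ᴹ; _≉ᴹ_)

  X∣F : LeftModule (fieldRing F) ℓ ℓ
  X∣F = restrictScalars ι X

  open Linear X∣F public using (HasDim; DimAtMost)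
  open Linear X∣F using (InvertibleSemilinear)

  Subspace : Set (lsuc ℓ)
  Subspace = Linear.Subspace X∣F ℓ

  ⟪_⟫ : Subspace → Pred Carrierᴹ ℓ
  ⟪_⟫ = Linear.Subspace.set

  subspaceSetoid : Setoid (lsuc ℓ) ℓ
  subspaceSetoid = On.setoid (≐-setoid Carrierᴹ ℓ) ⟪_⟫

  infix 4 _≗_
  _≗_ : Rel Subspace ℓ
  _≗_ = Setoid._≈_ subspaceSetoid

  record Collection : Set (lsuc (lsuc ℓ)) where
    field
      member   : Pred Subspace (lsuc ℓ)
      respects : member Respects _≗_

  open Collection public using (member)

  elements : Collection → Setoid (lsuc ℓ) ℓ
  elements 𝒜 = On.setoid subspaceSetoid (proj₁ {B = member 𝒜})

  record IsPartialSpread (m : ℕ) (𝒜 : Collection) : Set (lsuc ℓ) where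
    field
      dimension : ∀ S → S ∈ member 𝒜 → HasDim ⟪ S ⟫ m
      disjoint  : ∀ S S′ → S ∈ member 𝒜 → S′ ∈ member 𝒜 → ¬ (S ≗ S′) →
                  (⟪ S ⟫ ∩ ⟪ S′ ⟫) ≐ (_≈ᴹ 0ᴹ)

  record IsSpread (m : ℕ) (𝒜 : Collection) : Set (lsuc ℓ) where
    field
      isPartialSpread : IsPartialSpread m 𝒜
      covers          : ∀ x → x ≉ᴹ 0ᴹ → ∃! _≗_ (λ S → S ∈ member 𝒜 × x ∈ ⟪ S ⟫)

  K-span : Carrierᴹ → Pred Carrierᴹ ℓ
  K-span x y = ∃[ k ] k *ₗ x ≈ᴹ y

  𝒟 : Pred Subspace ℓ
  𝒟 S = ∃[ x ] x ≉ᴹ 0ᴹ × ⟪ S ⟫ ≐ K-span x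

  infix 8 _[_]
  _[_] : InvertibleSemilinear → Pred Carrierᴹ ℓ → Pred Carrierᴹ ℓ
  (g [ T ]) y = ∃[ x ] x ∈ T × InvertibleSemilinear.φ g x ≈ᴹ y

  imageOf𝒟 : InvertibleSemilinear → Pred Subspace (lsuc ℓ)
  imageOf𝒟 g S = ∃[ T ] T ∈ 𝒟 × ⟪ S ⟫ ≐ g [ ⟪ T ⟫ ]

  IsDesarguesian : ℕ → Collection → Set (lsuc ℓ)
  IsDesarguesian m ℬ = IsSpread m ℬ × ∃[ g ] member ℬ ≐ imageOf𝒟 g

  IsPartialDesarguesian : ℕ → Collection → Set (lsuc (lsuc ℓ))
  IsPartialDesarguesian m 𝒜 =
    IsPartialSpread m 𝒜 ×
    (∃[ ℬ ] IsDesarguesian m ℬ × (∀ S → S ∈ member 𝒜 → S ∈ member ℬ))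

  IsEvasive : Collection → ℕ → Subspace → Set (lsuc ℓ)
  IsEvasive 𝒜 h U = ∀ S → S ∈ member 𝒜 → DimAtMost (⟪ U ⟫ ∩ ⟪ S ⟫) h

-- In coordinates X = K × Kⁿ⁻¹, take for 𝒜 the lines spanned by the affine
-- points (1 , v), and for W the vectors whose first coordinate lies in an
-- h-dimensional F-subspace V of K.  Then W meets the line of (1 , v) exactly in
-- V · (1 , v), which has dimension h.  That K has dimension m over F, and has
-- F-subspaces of every dimension h ≤ m, follows by counting: an independent
-- family of size d yields qᵈ distinct combinations, so as long as qᵈ < qᵐ some
-- element lies outside its span and extends it.

module Submission where

open import Defs
open import Data.Nat.Base using (ℕ; _+_; _*_; _∸_; _^_; _≤_)
open import Data.Product using (∃-syntax; _×_)
open import Relation.Unary using (U)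
open import Algebra.Apartness.Bundles using (HeytingField)
open import Algebra.Module.Bundles using (LeftModule)

open import Level using (Level; Lift; lift)
import Data.Nat.Base as ℕ
import Data.Nat.Properties as ℕ
open import Data.Nat.Primality using (prime⇒nonTrivial)
open import Data.Fin.Base using (Fin; zero; suc; _↑ˡ_; _↑ʳ_; splitAt; join; finToFun; funToFin; combine)
import Data.Fin.Properties as Fin
open import Data.Product using (_,_; proj₁; proj₂)
open import Data.Sum.Base using (inj₁; inj₂; [_,_]′)
open import Data.Unit.Polymorphic.Base using (⊤; tt)
open import Data.Vec.Functional using (_∷_; _++_; head; tail)
open import Data.Vec.Functional.Properties using (lookup-++ˡ; lookup-++ʳ)
open import Data.Vec.Functional.Relation.Binary.Equality.Setoid using (≋-setoid)
open import Function.Base using (_∘_; id)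
open import Function.Bundles using (Bijection)
import Function.Construct.Composition as Composition
open import Relation.Nullary using (¬_; Dec; yes; no; contradiction)
open import Relation.Nullary.Decidable using (map′)
open import Relation.Unary using (Pred; _∈_; _∩_; _⊆_; _≐_)
open import Relation.Unary.Properties using (≐-refl; ≐-sym; ≐-trans)
open import Relation.Binary.Bundles using (Setoid)
open import Relation.Binary.Definitions using (Decidable)
open import Relation.Binary.PropositionalEquality as ≡ using (_≡_)
import Relation.Binary.Reasoning.Setoid as ≈-Reasoning
open import Algebra.Bundles using (Ring)
import Algebra.Properties.Group as GroupProperties
import Algebra.Properties.CommutativeMonoid.Sum as SumProperties
import Algebra.Module.Properties.LeftModule as LeftModuleProperties
import Algebra.Module.Construct.TensorUnit as TensorUnit
import Algebra.Morphism.Construct.Identity as Identity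
import Algebra.Apartness.Properties.HeytingCommutativeRing as HeytingProperties
open import Algebra.Morphism.Bundles using (RingHomomorphism)

private
  variable
    a a′ ℓ ℓ₁ ℓ₂ p : Level

-- Finite setoids: decidable equality, exhaustive search and counting.

module FiniteSetoid {S : Setoid a ℓ} {N : ℕ} (size : HasSize S N) where

  open Setoid S
  open Bijection size using (to; injective; strictlySurjective)

  index : Carrier → Fin N
  index x = proj₁ (strictlySurjective x)

  to-index : ∀ x → to (index x) ≈ x
  to-index x = proj₂ (strictlySurjective x)

  index-injective : ∀ {x y} → index x ≡ index y → x ≈ y
  index-injective {x} {y} eq =
    trans (sym (to-index x)) (trans (reflexive (≡.cong to eq)) (to-index y))

  -- The chosen preimage is the only one, since `to` is injective; hence the choice respects
  -- equality although surjectivity alone does not say so.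
  index-cong : ∀ {x y} → x ≈ y → index x ≡ index y
  index-cong {x} {y} x≈y = injective (trans (to-index x) (trans x≈y (sym (to-index y))))

  _≟_ : Decidable _≈_
  x ≟ y = map′ index-injective index-cong (index x Fin.≟ index y)

  any? : {P : Pred Carrier p} → (∀ {x y} → x ≈ y → P x → P y) →
         (∀ x → Dec (P x)) → Dec (∃[ x ] P x)
  any? resp P? = map′ (λ (i , Pi) → to i , Pi)
                      (λ (x , Px) → index x , resp (sym (to-index x)) Px)
                      (Fin.any? (P? ∘ to))

  -- Constructive substitute for classical logic: a decidable predicate is tested on each of the `N`
  -- representatives until one fails.
  ¬∀⇒∃¬ : {P : Pred Carrier p} → (∀ {x y} → x ≈ y → P x → P y) →
          (∀ x → Dec (P x)) → ¬ (∀ x → P x) → ∃[ x ] ¬ P x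
  ¬∀⇒∃¬ {P = P} resp P? ¬∀ with Fin.¬∀⟶∃¬ N (P ∘ to) (P? ∘ to)
    (λ ∀P → ¬∀ (λ x → resp (to-index x) (∀P (index x))))
  ... | i , ¬Pi = to i , ¬Pi

-- Pigeonhole on `Fin`. Of `f` only reflection of equality is asked, so `f` may be a choice of
-- coordinates, as in `spanning⇒≤^`.
size-mono : {S : Setoid a ℓ₁} {T : Setoid a′ ℓ₂} {M N : ℕ} → HasSize S M → HasSize T N →
            (f : Setoid.Carrier S → Setoid.Carrier T) →
            (∀ {x y} → Setoid._≈_ T (f x) (f y) → Setoid._≈_ S x y) → M ≤ N
size-mono sizeS sizeT f f-injective = Fin.injective⇒≤
  (Bijection.injective sizeS ∘ f-injective ∘ FiniteSetoid.index-injective sizeT)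

funToFin-cong : ∀ {m n} {f g : Fin m → Fin n} → (∀ i → f i ≡ g i) → funToFin f ≡ funToFin g
funToFin-cong {ℕ.zero}  eq = ≡.refl
funToFin-cong {ℕ.suc m} eq = ≡.cong₂ combine (eq zero) (funToFin-cong (eq ∘ suc))

-- A number below `N ^ d` is read as its `d` digits in base `N`, and each digit is decoded by `to`.
vectors-size : {S : Setoid a ℓ} {N : ℕ} → HasSize S N → ∀ d → HasSize (≋-setoid S d) (N ^ d)
vectors-size {S = S} {N} size d = record
  { to        = λ k → to ∘ finToFun {N} {d} k
  ; cong      = λ { ≡.refl i → refl }
  ; bijective = (λ {x} {y} eq →
      ≡.trans (≡.sym (Fin.funToFin-finToFin {d} {N} x))
        (≡.trans (funToFin-cong (injective ∘ eq)) (Fin.funToFin-finToFin {d} {N} y)))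
    , λ v → funToFin (index ∘ v) , λ { ≡.refl i →
        trans (reflexive (≡.cong to (Fin.finToFun-funToFin (index ∘ v) i))) (to-index (v i)) }
  }
  where
  open Setoid S
  open Bijection size using (to; injective)
  open FiniteSetoid size using (index; to-index)

-- Linear combinations, independence, spans and direct sums.

module LinearProperties {r ℓr m ℓm : Level} {R : Ring r ℓr} (M : LeftModule R m ℓm) where

  open Ring R hiding (zero) renaming (_+_ to _+ˢ_; _*_ to _*ˢ_; Carrier to Scalar)
  open LeftModule M
  open Linear M
  open LeftModuleProperties M
  open SumProperties +ᴹ-commutativeMonoid using (sum; sum-cong-≋; ∑-distrib-+; sum-replicate-zero)
  open ≈-Reasoning ≈ᴹ-setoid

  private
    variable
      d e : ℕ

  -ᴹ≈-1*ₗ : ∀ x → (- 1#) *ₗ x ≈ᴹ -ᴹ x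
  -ᴹ≈-1*ₗ x = inverseʳ-uniqueᴹ _ _ (begin
    x +ᴹ (- 1#) *ₗ x         ≈⟨ +ᴹ-congʳ (*ₗ-identityˡ x) ⟨
    1# *ₗ x +ᴹ (- 1#) *ₗ x   ≈⟨ *ₗ-distribʳ x 1# (- 1#) ⟨
    (1# +ˢ - 1#) *ₗ x        ≈⟨ *ₗ-congʳ (-‿inverseʳ 1#) ⟩
    0# *ₗ x                  ≈⟨ *ₗ-zeroˡ x ⟩
    0ᴹ                       ∎)

  sum-↑ : ∀ d {e} (f : Fin (d + e) → Carrierᴹ) →
          sum f ≈ᴹ sum (f ∘ (_↑ˡ e)) +ᴹ sum (f ∘ (d ↑ʳ_))
  sum-↑ ℕ.zero    f = ≈ᴹ-sym (+ᴹ-identityˡ _)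
  sum-↑ (ℕ.suc d) f = ≈ᴹ-trans (+ᴹ-congˡ (sum-↑ d (f ∘ suc))) (≈ᴹ-sym (+ᴹ-assoc _ _ _))

  combination-cong : {c c′ : Fin d → Scalar} {b b′ : Fin d → Carrierᴹ} →
                     (∀ i → c i ≈ c′ i) → (∀ i → b i ≈ᴹ b′ i) →
                     combination c b ≈ᴹ combination c′ b′
  combination-cong c≈c′ b≈b′ = sum-cong-≋ (λ i → *ₗ-cong (c≈c′ i) (b≈b′ i))

  combination-congˡ : {c c′ : Fin d → Scalar} {b : Fin d → Carrierᴹ} →
                      (∀ i → c i ≈ c′ i) → combination c b ≈ᴹ combination c′ b
  combination-congˡ c≈c′ = combination-cong c≈c′ (λ _ → ≈ᴹ-refl)

  combination-+ : (c c′ : Fin d → Scalar) (b : Fin d → Carrierᴹ) →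
                  combination (λ i → c i +ˢ c′ i) b ≈ᴹ combination c b +ᴹ combination c′ b
  combination-+ c c′ b =
    ≈ᴹ-trans (sum-cong-≋ (λ i → *ₗ-distribʳ (b i) (c i) (c′ i)))
    (∑-distrib-+ (λ i → c i *ₗ b i) (λ i → c′ i *ₗ b i))

  combination-* : ∀ s (c : Fin d → Scalar) (b : Fin d → Carrierᴹ) →
                  combination (λ i → s *ˢ c i) b ≈ᴹ s *ₗ combination c b
  combination-* {ℕ.zero}  s c b = ≈ᴹ-sym (*ₗ-zeroʳ s)
  combination-* {ℕ.suc d} s c b = ≈ᴹ-trans
    (+ᴹ-cong (*ₗ-assoc s (c zero) (b zero)) (combination-* s (c ∘ suc) (b ∘ suc)))
    (≈ᴹ-sym (*ₗ-distribˡ s _ _))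

  combination-0 : {c : Fin d → Scalar} {b : Fin d → Carrierᴹ} →
                  (∀ i → c i ≈ 0#) → combination c b ≈ᴹ 0ᴹ
  combination-0 {d} {b = b} c≈0 = ≈ᴹ-trans
    (sum-cong-≋ (λ i → ≈ᴹ-trans (*ₗ-congʳ (c≈0 i)) (*ₗ-zeroˡ (b i))))
    (sum-replicate-zero d)

  combination-neg : (c : Fin d → Scalar) (b : Fin d → Carrierᴹ) →
                    combination (λ i → - c i) b ≈ᴹ -ᴹ combination c b
  combination-neg c b = inverseʳ-uniqueᴹ _ _
    (≈ᴹ-trans (≈ᴹ-sym (combination-+ c _ b)) (combination-0 (λ i → -‿inverseʳ (c i))))

  combination-++ : (c : Fin (d + e) → Scalar) (b : Fin d → Carrierᴹ) (b′ : Fin e → Carrierᴹ) →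
                   combination c (b ++ b′) ≈ᴹ
                   combination (c ∘ (_↑ˡ e)) b +ᴹ combination (c ∘ (d ↑ʳ_)) b′
  combination-++ {d} {e} c b b′ = ≈ᴹ-trans (sum-↑ d _) (+ᴹ-cong
    (sum-cong-≋ (λ i → *ₗ-congˡ (≈ᴹ-reflexive (lookup-++ˡ b b′ i))))
    (sum-cong-≋ (λ i → *ₗ-congˡ (≈ᴹ-reflexive (lookup-++ʳ b b′ i)))))

  Independent : (Fin d → Carrierᴹ) → Set _
  Independent b = ∀ c → combination c b ≈ᴹ 0ᴹ → ∀ i → c i ≈ 0#

  Span : (Fin d → Carrierᴹ) → Pred Carrierᴹ _
  Span b x = ∃[ c ] combination c b ≈ᴹ x

  -- The difference of the two coefficient vectors is a linear relation on `b`, hence zero.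
  coordinates-unique : (b : Fin d → Carrierᴹ) → Independent b → ∀ {c c′} →
                       combination c b ≈ᴹ combination c′ b → ∀ i → c i ≈ c′ i
  coordinates-unique b ind {c} {c′} eq i =
    GroupProperties.x∙y⁻¹≈ε⇒x≈y +-group (c i) (c′ i) (ind (λ i → c i +ˢ - c′ i) (begin
      combination (λ i → c i +ˢ - c′ i) b                ≈⟨ combination-+ c _ b ⟩
      combination c b +ᴹ combination (λ i → - c′ i) b    ≈⟨ +ᴹ-cong eq (combination-neg c′ b) ⟩
      combination c′ b +ᴹ -ᴹ combination c′ b            ≈⟨ -ᴹ‿inverseʳ _ ⟩
      0ᴹ                                                 ∎) i)

  independent-tail : (b : Fin (ℕ.suc d) → Carrierᴹ) → Independent b → Independent (tail b)
  independent-tail b ind c eq i =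
    ind (0# ∷ c) (≈ᴹ-trans (+ᴹ-cong (*ₗ-zeroˡ _) eq) (+ᴹ-identityˡ 0ᴹ)) (suc i)

  combination-1∷0 : (b : Fin (ℕ.suc d) → Carrierᴹ) → combination (1# ∷ λ _ → 0#) b ≈ᴹ head b
  combination-1∷0 b = ≈ᴹ-trans
    (+ᴹ-cong (*ₗ-identityˡ (head b)) (combination-0 {b = tail b} (λ _ → refl)))
    (+ᴹ-identityʳ (head b))

  independent⇒head≉0 : ¬ 1# ≈ 0# → (b : Fin (ℕ.suc d) → Carrierᴹ) → Independent b → head b ≉ᴹ 0ᴹ
  independent⇒head≉0 1≉0 b ind b₀≈0 =
    1≉0 (ind (1# ∷ λ _ → 0#) (≈ᴹ-trans (combination-1∷0 b) b₀≈0) zero)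

  ∈-span : (b : Fin d → Carrierᴹ) → ∀ i → b i ∈ Span b
  ∈-span b zero    = (1# ∷ λ _ → 0#) , combination-1∷0 b
  ∈-span b (suc i) with ∈-span (tail b) i
  ... | c , eq = (0# ∷ c) , ≈ᴹ-trans (+ᴹ-cong (*ₗ-zeroˡ _) eq) (+ᴹ-identityˡ _)

  span : (Fin d → Carrierᴹ) → Subspace _
  span b = record
    { set       = Span b
    ; respects  = λ { x≈y (c , eq) → c , ≈ᴹ-trans eq x≈y }
    ; 0-closed  = (λ _ → 0#) , combination-0 {b = b} (λ _ → refl)
    ; +-closed  = λ { (c , eq) (c′ , eq′) →
        (λ i → c i +ˢ c′ i) , ≈ᴹ-trans (combination-+ c c′ b) (+ᴹ-cong eq eq′) }
    ; *ₗ-closed = λ { s (c , eq) →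
        (λ i → s *ˢ c i) , ≈ᴹ-trans (combination-* s c b) (*ₗ-congˡ eq) }
    }

  HasDim-span : (b : Fin d → Carrierᴹ) → Independent b → HasDim (Span b) d
  HasDim-span b ind = b , record
    { members = ∈-span b ; independent = ind ; spanning = λ _ x∈ → x∈ }

  module _ (P : Subspace p) where
    open Subspace P

    -ᴹ-closed : ∀ {x} → x ∈ set → -ᴹ x ∈ set
    -ᴹ-closed x∈P = respects (-ᴹ≈-1*ₗ _) (*ₗ-closed (- 1#) x∈P)

    combination-closed : (c : Fin d → Scalar) {b : Fin d → Carrierᴹ} →
                         (∀ i → b i ∈ set) → combination c b ∈ set
    combination-closed {ℕ.zero}  c b∈P = 0-closed
    combination-closed {ℕ.suc d} c b∈P =
      +-closed (*ₗ-closed (c zero) (b∈P zero)) (combination-closed (c ∘ suc) (b∈P ∘ suc))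

  HasDim-≐ : {P : Pred Carrierᴹ ℓ₁} {Q : Pred Carrierᴹ ℓ₂} → P ≐ Q → HasDim P d → HasDim Q d
  HasDim-≐ (P⊆Q , Q⊆P) (b , isBasis) = b , record
    { members     = λ i → P⊆Q (members i)
    ; independent = independent
    ; spanning    = λ x x∈Q → spanning x (Q⊆P x∈Q)
    }
    where open IsBasis isBasis

  infixl 6 _⊞_
  _⊞_ : Pred Carrierᴹ ℓ₁ → Pred Carrierᴹ ℓ₂ → Pred Carrierᴹ _
  (P ⊞ Q) x = ∃[ u ] ∃[ v ] u ∈ P × v ∈ Q × u +ᴹ v ≈ᴹ x

  open Subspace

  -- Bases of the two summands are concatenated. A relation on the result splits as `u +ᴹ v ≈ᴹ 0ᴹ`
  -- with `u` in `P` and `v` in `Q`; then `u` is `-ᴹ v`, so both lie in the trivial intersection and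
  -- each basis can be treated separately.
  HasDim-⊞ : (P : Subspace ℓ₁) (Q : Subspace ℓ₂) →
             (∀ {x} → x ∈ set P → x ∈ set Q → x ≈ᴹ 0ᴹ) →
             HasDim (set P) d → HasDim (set Q) e → HasDim (set P ⊞ set Q) (d + e)
  HasDim-⊞ {d = d} {e} P Q disjoint (b , isBasis) (b′ , isBasis′) = b ++ b′ , record
    { members     = λ i → members (splitAt d i)
    ; independent = λ c eq i → independent c eq (splitAt d i) (Fin.join-splitAt d e i)
    ; spanning    = λ { x (u , v , u∈P , v∈Q , u+v≈x) →
        let (c , c≈u) = B.spanning u u∈P ; (c′ , c′≈v) = B′.spanning v v∈Q in
        c ++ c′ , (begin
          combination (c ++ c′) (b ++ b′)                                ≈⟨ combination-++ (c ++ c′) b b′ ⟩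
          combination ((c ++ c′) ∘ (_↑ˡ e)) b +ᴹ combination ((c ++ c′) ∘ (d ↑ʳ_)) b′
            ≈⟨ +ᴹ-cong (combination-congˡ (λ i → reflexive (lookup-++ˡ c c′ i)))
                       (combination-congˡ (λ i → reflexive (lookup-++ʳ c c′ i))) ⟩
          combination c b +ᴹ combination c′ b′                           ≈⟨ +ᴹ-cong c≈u c′≈v ⟩
          u +ᴹ v                                                         ≈⟨ u+v≈x ⟩
          x                                                              ∎) }
    }
    where
    module B = IsBasis isBasis
    module B′ = IsBasis isBasis′

    members : ∀ s → [ b , b′ ]′ s ∈ set P ⊞ set Q
    members (inj₁ i) = b i , 0ᴹ , B.members i , 0-closed Q , +ᴹ-identityʳ _
    members (inj₂ j) = 0ᴹ , b′ j , 0-closed P , B′.members j , +ᴹ-identityˡ _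

    module _ (c : Fin (d + e) → Scalar) (eq : combination c (b ++ b′) ≈ᴹ 0ᴹ) where
      u v : Carrierᴹ
      u = combination (c ∘ (_↑ˡ e)) b
      v = combination (c ∘ (d ↑ʳ_)) b′

      u+v≈0 : u +ᴹ v ≈ᴹ 0ᴹ
      u+v≈0 = ≈ᴹ-trans (≈ᴹ-sym (combination-++ c b b′)) eq

      u∈P : u ∈ set P
      u∈P = combination-closed P _ B.members

      v∈Q : v ∈ set Q
      v∈Q = combination-closed Q _ B′.members

      u≈0 : u ≈ᴹ 0ᴹ
      u≈0 = disjoint u∈P (respects Q (≈ᴹ-sym (inverseˡ-uniqueᴹ _ _ u+v≈0)) (-ᴹ-closed Q v∈Q))

      v≈0 : v ≈ᴹ 0ᴹ
      v≈0 = disjoint (respects P (≈ᴹ-sym (inverseʳ-uniqueᴹ _ _ u+v≈0)) (-ᴹ-closed P u∈P)) v∈Q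

      -- The index is presented as `join d e s`, so that matching on the equality turns `i` into a
      -- left or a right index.
      independent : ∀ {i} s → join d e s ≡ i → c i ≈ 0#
      independent (inj₁ j) ≡.refl = B.independent _ u≈0 j
      independent (inj₂ j) ≡.refl = B′.independent _ v≈0 j

-- Inverses in a finite Heyting field.

module FiniteField (F : HeytingField a ℓ₁ ℓ₂) {q : ℕ} (size : HasSize (HeytingField.setoid F) q) where

  open HeytingField F renaming (_+_ to _+ˢ_; _*_ to _*ˢ_)
  open FiniteSetoid size using (_≟_; any?)
  open HeytingProperties heytingCommutativeRing using (1#0; x-0≈x; invertibleˡ⇒#)

  1≉0 : ¬ 1# ≈ 0#
  1≉0 1≈0 = proj₂ (tight 1# 0#) 1≈0 1#0

  -- Apartness is not assumed decidable; searching the finite field for an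
  -- inverse decides whether x # 0#, and tightness does the rest.
  inverse : ∀ {x} → ¬ x ≈ 0# → ∃[ y ] y *ˢ x ≈ 1#
  inverse {x} x≉0 with any? (λ y≈z → trans (*-congʳ (sym y≈z))) (λ y → (y *ˢ x) ≟ 1#)
  ... | yes inv  = inv
  ... | no ¬inv  = contradiction (proj₁ (tight x 0#) ¬x#0) x≉0
    where
    ¬x#0 : ¬ x # 0#
    ¬x#0 x#0 with #⇒invertible x#0
    ... | y , yx≈1 , _ = ¬inv (y , trans (*-congˡ (sym (x-0≈x x))) yx≈1)

-- Counting arguments in a finite vector space over a finite field.

module FiniteSpace {r ℓr r# m ℓm : Level} {F : HeytingField r ℓr r#} {q : ℕ}
                   (sizeF : HasSize (HeytingField.setoid F) q)
                   (M : LeftModule (fieldRing F) m ℓm) {N : ℕ}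
                   (sizeM : HasSize (LeftModule.≈ᴹ-setoid M) N) where

  open Ring (fieldRing F) hiding (zero) renaming (_+_ to _+ˢ_; _*_ to _*ˢ_; Carrier to Scalar)
  open LeftModule M
  open Linear M
  open LinearProperties M
  open LeftModuleProperties M using (inverseˡ-uniqueᴹ)
  open FiniteField F sizeF using (inverse)
  open FiniteSetoid using (_≟_; any?; ¬∀⇒∃¬)

  private
    variable
      d : ℕ
      b : Fin d → Carrierᴹ

  -- Look at the coefficient of `v` in a relation. If it is zero, what remains is a relation on `b`;
  -- otherwise dividing by it expresses `v` through `b`, against the assumption.
  independent-∷ : ∀ {v} → Independent b → ¬ v ∈ Span b → Independent (v ∷ b)
  independent-∷ {d} {b} {v} ind v∉ c eq with _≟_ sizeF (c zero) 0#
  ... | yes c₀≈0 = λ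
    { zero    → c₀≈0
    ; (suc i) → ind (tail c) (begin
        combination (tail c) b                    ≈⟨ +ᴹ-identityˡ _ ⟨
        0ᴹ +ᴹ combination (tail c) b              ≈⟨ +ᴹ-congʳ (*ₗ-zeroˡ v) ⟨
        0# *ₗ v +ᴹ combination (tail c) b         ≈⟨ +ᴹ-congʳ (*ₗ-congʳ c₀≈0) ⟨
        c zero *ₗ v +ᴹ combination (tail c) b     ≈⟨ eq ⟩
        0ᴹ                                        ∎) i
    }
    where open ≈-Reasoning ≈ᴹ-setoid
  ... | no c₀≉0 with inverse c₀≉0
  ...   | y , yc₀≈1 = contradiction ((λ i → y *ˢ - tail c i) , (begin
        combination (λ i → y *ˢ - tail c i) b     ≈⟨ combination-* y _ b ⟩
        y *ₗ combination (λ i → - tail c i) b     ≈⟨ *ₗ-congˡ (combination-neg (tail c) b) ⟩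
        y *ₗ -ᴹ combination (tail c) b            ≈⟨ *ₗ-congˡ (inverseˡ-uniqueᴹ _ _ eq) ⟨
        y *ₗ (c zero *ₗ v)                        ≈⟨ *ₗ-assoc y (c zero) v ⟨
        (y *ˢ c zero) *ₗ v                        ≈⟨ *ₗ-congʳ yc₀≈1 ⟩
        1# *ₗ v                                   ≈⟨ *ₗ-identityˡ v ⟩
        v                                         ∎)) v∉
    where open ≈-Reasoning ≈ᴹ-setoid

  -- There are only `q ^ d` coefficient vectors to try, and equality in the finite module is
  -- decidable.
  _∈Span?_ : ∀ x (b : Fin d → Carrierᴹ) → Dec (x ∈ Span b)
  _∈Span?_ {d} x b = any? (vectors-size sizeF d)
    (λ c≈c′ eq → ≈ᴹ-trans (combination-congˡ (sym ∘ c≈c′)) eq)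
    (λ c → _≟_ sizeM (combination c b) x)

  -- By uniqueness of coordinates, distinct coefficient vectors give distinct elements.
  independent⇒^≤ : (b : Fin d → Carrierᴹ) → Independent b → q ^ d ≤ N
  independent⇒^≤ {d} b ind =
    size-mono (vectors-size sizeF d) sizeM (λ c → combination c b) (coordinates-unique b ind)

  -- Choosing coordinates for every element is injective, since the element is recovered as their
  -- combination.
  spanning⇒≤^ : (∀ x → x ∈ Span {d} b) → N ≤ q ^ d
  spanning⇒≤^ {d} {b} spans = size-mono sizeM (vectors-size sizeF d) (proj₁ ∘ spans)
    (λ {x} {y} eq → ≈ᴹ-trans (≈ᴹ-sym (proj₂ (spans x)))
                      (≈ᴹ-trans (combination-congˡ eq) (proj₂ (spans y))))

  -- An element outside the span would extend `b` to an independent family of `d + 1` elements,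
  -- which has more combinations than the space has elements.
  independent-spans : N ℕ.< q ^ ℕ.suc d → Independent {d} b → ∀ x → x ∈ Span b
  independent-spans {b = b} N<q^1+d ind x with x ∈Span? b
  ... | yes x∈ = x∈
  ... | no  x∉ = contradiction (independent⇒^≤ (x ∷ b) (independent-∷ {b = b} ind x∉)) (ℕ.<⇒≱ N<q^1+d)

  independentFamily : 1 ℕ.< q → ∀ d → q ^ d ≤ N → ∃[ b ] Independent {d} b
  independentFamily 1<q ℕ.zero    _   = (λ ()) , λ _ _ ()
  independentFamily 1<q (ℕ.suc d) q^1+d≤N =
    let q^d<N   = ℕ.<-≤-trans (ℕ.^-monoʳ-< q 1<q (ℕ.n<1+n d)) q^1+d≤N
        b , ind = independentFamily 1<q d (ℕ.<⇒≤ q^d<N)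
        -- As `q ^ d < N`, the family found so far cannot span; exhaustive search then produces an
        -- actual element outside its span.
        v , v∉  = ¬∀⇒∃¬ sizeM (λ { x≈y (c , eq) → c , ≈ᴹ-trans eq x≈y }) (_∈Span? b)
                    (λ spans → ℕ.<⇒≱ q^d<N (spanning⇒≤^ {b = b} spans))
    in v ∷ b , independent-∷ {b = b} ind v∉

-- The extension field as a vector space over the base field, and multiples of a vector by its
-- subspaces.

K∣F : {F K : HeytingField ℓ ℓ ℓ} → FieldExtension F K → LeftModule (fieldRing F) ℓ ℓ
K∣F {F = F} {K} ι =
  restrictScalars {R = fieldRing F} {S = fieldRing K} ι TensorUnit.leftModule

module DesarguesianSpread {ℓ : Level} {F K : HeytingField ℓ ℓ ℓ} (ι : FieldExtension F K)
         (X : LeftModule (fieldRing K) ℓ ℓ) {q m : ℕ} (1<q : 1 ℕ.< q)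
         (sizeF : HasSize (HeytingField.setoid F) q)
         (sizeK : HasSize (HeytingField.setoid K) (q ^ m)) where

  open Ring (fieldRing K) hiding (zero) renaming (_+_ to _+ˢ_; _*_ to _*ˢ_; Carrier to Scalar)
  open LeftModule X
  open Spreads {F = F} {K = K} ι X
  open RingHomomorphism ι using (⟦_⟧)
  open FiniteField K sizeK using (inverse; 1≉0)
  open FiniteSetoid sizeK using (_≟_)
  open LinearProperties X
  open Linear X using (combination)
  private
    module XF = Linear X∣F
    module XFₚ = LinearProperties X∣F

  private
    module KF = Linear (K∣F {F = F} {K} ι)

  open FiniteSpace {F = F} sizeF (K∣F {F = F} {K} ι) sizeK using (independentFamily; independent-spans)

  open ≈-Reasoning ≈ᴹ-setoid

  private
    variable
      d e n : ℕ
      x y : Carrierᴹ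

  -- The field `K` as a subspace of itself over `F`; `⊤ₖ · x` is then the full line through `x`, and
  -- also the free coordinates of a box use it.
  ⊤ₖ : KF.Subspace ℓ
  ⊤ₖ = record
    { set = λ _ → ⊤ ; respects = λ _ _ → tt ; 0-closed = tt
    ; +-closed = λ _ _ → tt ; *ₗ-closed = λ _ _ → tt }

  open KF.Subspace using (set)

  -- There are `m` independent elements because `K` has at least `q ^ m` elements, and they span
  -- because it has fewer than `q ^ (m + 1)`.
  HasDim-⊤ₖ : KF.HasDim (set ⊤ₖ) m
  HasDim-⊤ₖ =
    let b , ind = independentFamily 1<q m ℕ.≤-refl
    in b , record
      { members     = λ _ → tt
      ; independent = ind
      ; spanning    = λ x _ → independent-spans (ℕ.^-monoʳ-< q 1<q (ℕ.n<1+n m)) ind x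
      }

  *ₗ-cancel-0 : ∀ k → x ≉ᴹ 0ᴹ → k *ₗ x ≈ᴹ 0ᴹ → k ≈ 0#
  *ₗ-cancel-0 {x} k x≉0 kx≈0 with k ≟ 0#
  ... | yes k≈0 = k≈0
  ... | no  k≉0 with inverse k≉0
  ...   | j , jk≈1 = contradiction (begin
      x               ≈⟨ *ₗ-identityˡ x ⟨
      1# *ₗ x         ≈⟨ *ₗ-congʳ jk≈1 ⟨
      (j *ˢ k) *ₗ x   ≈⟨ *ₗ-assoc j k x ⟩
      j *ₗ (k *ₗ x)   ≈⟨ *ₗ-congˡ kx≈0 ⟩
      j *ₗ 0ᴹ         ≈⟨ *ₗ-zeroʳ j ⟩
      0ᴹ              ∎) x≉0

  infix 8 _·_
  _·_ : KF.Subspace ℓ → Carrierᴹ → Subspace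
  V · x = record
    { set       = λ y → ∃[ k ] k ∈ set V × k *ₗ x ≈ᴹ y
    ; respects  = λ { y≈z (k , k∈V , eq) → k , k∈V , ≈ᴹ-trans eq y≈z }
    ; 0-closed  = 0# , V.0-closed , *ₗ-zeroˡ x
    ; +-closed  = λ { (k , k∈V , eq) (l , l∈V , eq′) →
        k +ˢ l , V.+-closed k∈V l∈V , ≈ᴹ-trans (*ₗ-distribʳ x k l) (+ᴹ-cong eq eq′) }
    ; *ₗ-closed = λ { s (k , k∈V , eq) →
        ⟦ s ⟧ *ˢ k , V.*ₗ-closed s k∈V , ≈ᴹ-trans (*ₗ-assoc ⟦ s ⟧ k x) (*ₗ-congˡ eq) }
    }
    where module V = KF.Subspace V

  combination-*ₗ : ∀ c (b : Fin d → Scalar) x →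
                   XF.combination c (λ i → b i *ₗ x) ≈ᴹ KF.combination c b *ₗ x
  combination-*ₗ {ℕ.zero}  c b x = ≈ᴹ-sym (*ₗ-zeroˡ x)
  combination-*ₗ {ℕ.suc d} c b x = ≈ᴹ-trans
    (+ᴹ-cong (≈ᴹ-sym (*ₗ-assoc ⟦ c zero ⟧ (b zero) x)) (combination-*ₗ (c ∘ suc) (b ∘ suc) x))
    (≈ᴹ-sym (*ₗ-distribʳ x _ _))

  -- For non-zero `x` the map sending `k` to `k *ₗ x` is injective and linear over `F`, so it
  -- carries a basis of `V` to a basis of `V · x`.
  HasDim-· : (V : KF.Subspace ℓ) → x ≉ᴹ 0ᴹ → KF.HasDim (set V) d → HasDim ⟪ V · x ⟫ d
  HasDim-· {x} V x≉0 (b , isBasis) = (λ i → b i *ₗ x) , record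
    { members     = λ i → b i , members i , ≈ᴹ-refl
    ; independent = λ c eq →
        independent c (*ₗ-cancel-0 _ x≉0 (≈ᴹ-trans (≈ᴹ-sym (combination-*ₗ c b x)) eq))
    ; spanning    = λ { y (k , k∈V , kx≈y) →
        let c , c≈k = spanning k k∈V
        in c , ≈ᴹ-trans (combination-*ₗ c b x) (≈ᴹ-trans (*ₗ-congʳ c≈k) kx≈y) }
    }
    where open KF.IsBasis isBasis

  -- Lines over `K` and the Desarguesian spread.

  ⊤ₖ·≐K-span : ⟪ ⊤ₖ · x ⟫ ≐ K-span x
  ⊤ₖ·≐K-span = (λ { (k , _ , eq) → k , eq }) , (λ { (k , eq) → k , tt , eq })

  K-span-⊆ : y ∈ K-span x → K-span y ⊆ K-span x
  K-span-⊆ {y} {x} (k , kx≈y) (l , ly≈z) =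
    l *ˢ k , ≈ᴹ-trans (*ₗ-assoc l k x) (≈ᴹ-trans (*ₗ-congˡ kx≈y) ly≈z)

  K-span-cong : x ≈ᴹ y → K-span x ≐ K-span y
  K-span-cong {x} {y} x≈y =
    K-span-⊆ (1# , ≈ᴹ-trans (*ₗ-identityˡ y) (≈ᴹ-sym x≈y)) ,
    K-span-⊆ (1# , ≈ᴹ-trans (*ₗ-identityˡ x) x≈y)

  -- The scalar taking `x` to the non-zero vector `y` is itself non-zero, so its inverse takes `y`
  -- back to `x`. Thus any non-zero vector of a line generates it.
  K-span-≐ : y ∈ K-span x → y ≉ᴹ 0ᴹ → K-span y ≐ K-span x
  K-span-≐ {y} {x} y∈@(k , kx≈y) y≉0 = K-span-⊆ y∈ , K-span-⊆ x∈
    where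
    k≉0 : ¬ k ≈ 0#
    k≉0 k≈0 = y≉0 (≈ᴹ-trans (≈ᴹ-sym kx≈y) (≈ᴹ-trans (*ₗ-congʳ k≈0) (*ₗ-zeroˡ x)))

    x∈ : x ∈ K-span y
    x∈ with inverse k≉0
    ... | j , jk≈1 = j , (begin
      j *ₗ y          ≈⟨ *ₗ-congˡ kx≈y ⟨
      j *ₗ (k *ₗ x)   ≈⟨ *ₗ-assoc j k x ⟨
      (j *ˢ k) *ₗ x   ≈⟨ *ₗ-congʳ jk≈1 ⟩
      1# *ₗ x         ≈⟨ *ₗ-identityˡ x ⟩
      x               ∎)

  line : Carrierᴹ → Subspace
  line x = record
    { set       = K-span x
    ; respects  = λ { y≈z (k , eq) → k , ≈ᴹ-trans eq y≈z }
    ; 0-closed  = proj₁ ⊤ₖ·≐K-span (0-closed (⊤ₖ · x))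
    ; +-closed  = λ y∈ z∈ → proj₁ ⊤ₖ·≐K-span
        (+-closed (⊤ₖ · x) (proj₂ ⊤ₖ·≐K-span y∈) (proj₂ ⊤ₖ·≐K-span z∈))
    ; *ₗ-closed = λ s y∈ → proj₁ ⊤ₖ·≐K-span (*ₗ-closed (⊤ₖ · x) s (proj₂ ⊤ₖ·≐K-span y∈))
    }
    where open Linear.Subspace

  identity : XF.InvertibleSemilinear
  identity = record
    { σ = id
    ; φ = id
    ; σ-isAutomorphism = Identity.isRingIsomorphism (Ring.rawRing (fieldRing F)) (Ring.refl (fieldRing F))
    ; φ-isGroupIso     = Identity.isGroupIsomorphism +ᴹ-rawGroup ≈ᴹ-refl
    ; φ-semilinear     = λ _ _ → ≈ᴹ-refl
    }

  -- This is 𝒟, with its universe level raised by passing to the image under the identity.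
  desarguesian : Collection
  desarguesian = record
    { member   = imageOf𝒟 identity
    ; respects = λ { S≗S′ (T , T∈𝒟 , S≐T) → T , T∈𝒟 , ≐-trans (≐-sym S≗S′) S≐T }
    }

  line∈desarguesian : x ≉ᴹ 0ᴹ → line x ∈ member desarguesian
  line∈desarguesian {x} x≉0 = line x , (x , x≉0 , ≐-refl) ,
    (λ {y} y∈ → y , y∈ , ≈ᴹ-refl) , λ { (y , y∈ , y≈z) → Linear.Subspace.respects (line x) y≈z y∈ }

  desarguesian⇒line : ∀ S → S ∈ member desarguesian → ∃[ x ] x ≉ᴹ 0ᴹ × ⟪ S ⟫ ≐ K-span x
  desarguesian⇒line S (T , (x , x≉0 , T≐) , S≐T) = x , x≉0 ,
    ≐-trans S≐T ((λ { (y , y∈T , y≈z) → Linear.Subspace.respects (line x) y≈z (proj₁ T≐ y∈T) }) ,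
                 (λ {z} z∈ → z , proj₂ T≐ z∈ , ≈ᴹ-refl))

  desarguesian-isPartialSpread : IsPartialSpread m desarguesian
  desarguesian-isPartialSpread = record
    { dimension = λ S S∈ → let x , x≉0 , S≐x = desarguesian⇒line S S∈ in
        XFₚ.HasDim-≐ (≐-trans ⊤ₖ·≐K-span (≐-sym S≐x)) (HasDim-· ⊤ₖ x≉0 HasDim-⊤ₖ)
    ; disjoint  = λ S S′ S∈ S′∈ S≢S′ →
        (λ {z} → disjoint S S′ S∈ S′∈ S≢S′ {z}) ,
        λ z≈0 → Linear.Subspace.respects S (≈ᴹ-sym z≈0) (Linear.Subspace.0-closed S) ,
                Linear.Subspace.respects S′ (≈ᴹ-sym z≈0) (Linear.Subspace.0-closed S′)
    }
    where
    disjoint : ∀ S S′ → S ∈ member desarguesian → S′ ∈ member desarguesian → ¬ (S ≗ S′) →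
               ⟪ S ⟫ ∩ ⟪ S′ ⟫ ⊆ (_≈ᴹ 0ᴹ)
    disjoint S S′ S∈ S′∈ S≢S′ {z} (z∈S , z∈S′) with desarguesian⇒line S S∈ | desarguesian⇒line S′ S′∈
    ... | x , x≉0 , S≐x | x′ , _ , S′≐x′ with proj₁ S≐x z∈S
    ... | k , kx≈z with k ≟ 0#
    ... | yes k≈0 = ≈ᴹ-trans (≈ᴹ-sym kx≈z) (≈ᴹ-trans (*ₗ-congʳ k≈0) (*ₗ-zeroˡ x))
    -- Now `z` is non-zero and generates both lines, so the two members coincide.
    ... | no  k≉0 = contradiction
      (≐-trans S≐x (≐-trans (≐-sym (K-span-≐ (k , kx≈z) z≉0))
                     (≐-trans (K-span-≐ (proj₁ S′≐x′ z∈S′) z≉0) (≐-sym S′≐x′))))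
      S≢S′
      where
      z≉0 : z ≉ᴹ 0ᴹ
      z≉0 z≈0 = k≉0 (*ₗ-cancel-0 k x≉0 (≈ᴹ-trans kx≈z z≈0))

  desarguesian-isSpread : IsSpread m desarguesian
  desarguesian-isSpread = record
    { isPartialSpread = desarguesian-isPartialSpread
    ; covers = λ x x≉0 → line x , (line∈desarguesian x≉0 , 1# , *ₗ-identityˡ x) ,
        λ { {S} (S∈ , x∈S) → let x′ , _ , S≐x′ = desarguesian⇒line S S∈ in
          ≐-trans (K-span-≐ (proj₁ S≐x′ x∈S) x≉0) (≐-sym S≐x′) }
    }

  -- Both conditions on a partial spread pass to subcollections, and the ambient Desarguesian spread
  -- is the image of `𝒟` under the identity.
  partialDesarguesian : (𝒜 : Collection) → (∀ S → S ∈ member 𝒜 → S ∈ member desarguesian) →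
                        IsPartialDesarguesian m 𝒜
  partialDesarguesian 𝒜 𝒜⊆𝒟 =
    record { dimension = λ S S∈ → dimension S (𝒜⊆𝒟 S S∈)
           ; disjoint  = λ S S′ S∈ S′∈ → disjoint S S′ (𝒜⊆𝒟 S S∈) (𝒜⊆𝒟 S′ S′∈) } ,
    desarguesian , (desarguesian-isSpread , identity , ≐-refl) , 𝒜⊆𝒟
    where open IsPartialSpread desarguesian-isPartialSpread

  -- Boxes: coordinates over `K` restricted to subspaces over `F`.

  box : (Fin n → KF.Subspace ℓ) → (Fin n → Carrierᴹ) → Subspace
  box V b = record
    { set       = λ y → ∃[ c ] (∀ i → c i ∈ set (V i)) × combination c b ≈ᴹ y
    ; respects  = λ { y≈z (c , c∈V , eq) → c , c∈V , ≈ᴹ-trans eq y≈z }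
    ; 0-closed  = (λ _ → 0#) , (λ i → 0-closed (V i)) , combination-0 {b = b} (λ _ → refl)
    ; +-closed  = λ { (c , c∈V , eq) (c′ , c′∈V , eq′) →
        (λ i → c i +ˢ c′ i) , (λ i → +-closed (V i) (c∈V i) (c′∈V i)) ,
        ≈ᴹ-trans (combination-+ c c′ b) (+ᴹ-cong eq eq′) }
    ; *ₗ-closed = λ { s (c , c∈V , eq) →
        (λ i → ⟦ s ⟧ *ˢ c i) , (λ i → *ₗ-closed (V i) s (c∈V i)) ,
        ≈ᴹ-trans (combination-* ⟦ s ⟧ c b) (*ₗ-congˡ eq) }
    }
    where open KF.Subspace

  -- The box is the direct sum of its first coordinate axis and the box of the other coordinates.
  -- The first factor has a dimension of its own, because later it has dimension `h` while the
  -- others have dimension `m`.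
  HasDim-box-suc : (V : Fin (ℕ.suc n) → KF.Subspace ℓ) (b : Fin (ℕ.suc n) → Carrierᴹ) →
                   Independent b → KF.HasDim (set (head V)) d →
                   HasDim ⟪ box (tail V) (tail b) ⟫ e → HasDim ⟪ box V b ⟫ (d + e)
  HasDim-box-suc V b ind dimV₀ dimV =
    XFₚ.HasDim-≐ (to , from)
      (XFₚ.HasDim-⊞ (head V · head b) (box (tail V) (tail b)) disjoint
        (HasDim-· (head V) (independent⇒head≉0 1≉0 b ind) dimV₀) dimV)
    where
    to : ⟪ head V · head b ⟫ XFₚ.⊞ ⟪ box (tail V) (tail b) ⟫ ⊆ ⟪ box V b ⟫
    to (u , v , (k , k∈ , kb≈u) , (c , c∈ , cb≈v) , u+v≈y) =
      (k ∷ c) , (λ { zero → k∈ ; (suc i) → c∈ i }) , ≈ᴹ-trans (+ᴹ-cong kb≈u cb≈v) u+v≈y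

    from : ⟪ box V b ⟫ ⊆ ⟪ head V · head b ⟫ XFₚ.⊞ ⟪ box (tail V) (tail b) ⟫
    from (c , c∈ , eq) = _ , _ , (head c , c∈ zero , ≈ᴹ-refl) , (tail c , c∈ ∘ suc , ≈ᴹ-refl) , eq

    disjoint : ∀ {y} → y ∈ ⟪ head V · head b ⟫ → y ∈ ⟪ box (tail V) (tail b) ⟫ → y ≈ᴹ 0ᴹ
    disjoint {y} (k , _ , kb≈y) (c , _ , cb≈y) = begin
      y             ≈⟨ kb≈y ⟨
      k *ₗ head b   ≈⟨ *ₗ-congʳ (coordinates-unique b ind {k ∷ λ _ → 0#} {0# ∷ c} eq zero) ⟩
      0# *ₗ head b  ≈⟨ *ₗ-zeroˡ _ ⟩
      0ᴹ            ∎
      where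
      -- The common vector `y` has coordinates `(k, 0, ..., 0)` as well as `(0, c)`; comparing the
      -- first ones gives `k ≈ 0#`.
      eq : combination (k ∷ λ _ → 0#) b ≈ᴹ combination (0# ∷ c) b
      eq = begin
        k *ₗ head b +ᴹ combination (λ _ → 0#) (tail b)
          ≈⟨ +ᴹ-cong kb≈y (combination-0 {b = tail b} (λ _ → refl)) ⟩
        y +ᴹ 0ᴹ                                          ≈⟨ +ᴹ-comm y 0ᴹ ⟩
        0ᴹ +ᴹ y                                          ≈⟨ +ᴹ-cong (*ₗ-zeroˡ (head b)) cb≈y ⟨
        0# *ₗ head b +ᴹ combination c (tail b)           ∎

  HasDim-box : (V : Fin n → KF.Subspace ℓ) (b : Fin n → Carrierᴹ) → Independent b →
               (∀ i → KF.HasDim (set (V i)) d) → HasDim ⟪ box V b ⟫ (n * d)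
  HasDim-box {ℕ.zero}  V b ind dimV = (λ ()) , record
    { members = λ () ; independent = λ _ _ () ; spanning = λ { y (_ , _ , eq) → (λ ()) , eq } }
  HasDim-box {ℕ.suc n} V b ind dimV = HasDim-box-suc V b ind (dimV zero)
    (HasDim-box (tail V) (tail b) (independent-tail b ind) (dimV ∘ suc))

  -- Affine points and the evasive subspace; `n` is one less than the dimension of `X`.

  module AffinePoints {n : ℕ} (b : Fin (ℕ.suc n) → Carrierᴹ) (ind : Independent b) where

    point : (Fin n → Scalar) → Carrierᴹ
    point v = combination (1# ∷ v) b

    *ₗ-point : ∀ k v → combination (λ i → k *ˢ (1# ∷ v) i) b ≈ᴹ k *ₗ point v
    *ₗ-point k v = combination-* k (1# ∷ v) b

    point≉0 : ∀ v → point v ≉ᴹ 0ᴹ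
    point≉0 v eq = 1≉0 (ind (1# ∷ v) eq zero)

    -- The points of PG(n, K) off the hyperplane at infinity.
    𝒜 : Collection
    𝒜 = record
      { member   = λ S → Lift _ (∃[ v ] ⟪ S ⟫ ≐ K-span (point v))
      ; respects = λ { S≗S′ (lift (v , S≐)) → lift (v , ≐-trans (≐-sym S≗S′) S≐) }
      }

    𝒜⊆desarguesian : ∀ S → S ∈ member 𝒜 → S ∈ member desarguesian
    𝒜⊆desarguesian S (lift (v , S≐)) =
      Collection.respects desarguesian {line (point v)} {S} (≐-sym S≐)
        (line∈desarguesian (point≉0 v))

    -- If `point v` is `k` times `point w`, the leading coordinates, both normalised to `1#`, force
    -- `k ≈ 1#`.
    point-injective : ∀ v w → K-span (point v) ≐ K-span (point w) → ∀ i → v i ≈ w i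
    point-injective v w v≐w i with proj₁ v≐w (1# , *ₗ-identityˡ (point v))
    ... | k , eq = sym (trans (sym (*-identityˡ (w i)))
                     (trans (*-congʳ (trans (sym k≈1) (*-identityʳ k))) (coordinates (suc i))))
      where
      coordinates : ∀ i → k *ˢ (1# ∷ w) i ≈ (1# ∷ v) i
      coordinates = coordinates-unique b ind (≈ᴹ-trans (*ₗ-point k w) eq)

      k≈1 : k *ˢ 1# ≈ 1#
      k≈1 = coordinates zero

    -- The members correspond to the vectors `v` with `n` entries in `K`, of which there are
    -- `(q ^ m) ^ n`.
    𝒜-size : HasSize (elements 𝒜) (q ^ (m * n))
    𝒜-size = ≡.subst (HasSize (elements 𝒜)) (ℕ.^-*-assoc q m n)
      (Composition.bijection (vectors-size sizeK n) (record
        { to        = λ v → line (point v) , lift (v , ≐-refl)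
        ; cong      = λ {v} {w} → point-cong v w
        ; bijective = (λ {v} {w} → point-injective v w)
                    , λ { (S , lift (v , S≐)) → v , λ {w} w≋v → ≐-trans (point-cong w v w≋v) (≐-sym S≐) }
        }))
      where
      point-cong : ∀ v w → (∀ i → v i ≈ w i) → K-span (point v) ≐ K-span (point w)
      point-cong v w v≋w = K-span-cong (combination-congˡ
        {c = 1# ∷ v} {1# ∷ w} {b} λ { zero → refl ; (suc i) → v≋w i })

    module _ {h : ℕ} (V : KF.Subspace ℓ) (dimV : KF.HasDim (set V) h) where

      W : Subspace
      W = box (V ∷ λ _ → ⊤ₖ) b

      HasDim-W : HasDim ⟪ W ⟫ (m * n + h)
      HasDim-W = ≡.subst (HasDim ⟪ W ⟫)
        (≡.trans (ℕ.+-comm h (n * m)) (≡.cong (_+ h) (ℕ.*-comm n m)))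
        (HasDim-box-suc (V ∷ λ _ → ⊤ₖ) b ind dimV
          (HasDim-box (λ _ → ⊤ₖ) (tail b) (independent-tail b ind) (λ _ → HasDim-⊤ₖ)))

      -- The leading coordinate of `k *ₗ point v` is `k`, and the other coordinates of `W` are
      -- unrestricted; so membership in `W` amounts to `k` lying in `V`.
      W∩line : ∀ v → ⟪ V · point v ⟫ ≐ ⟪ W ⟫ ∩ K-span (point v)
      W∩line v =
        (λ { (k , k∈V , eq) →
          ( (λ i → k *ˢ (1# ∷ v) i)
          , (λ { zero → V.respects (sym (*-identityʳ k)) k∈V ; (suc i) → tt })
          , ≈ᴹ-trans (*ₗ-point k v) eq)
          , k , eq }) ,
        (λ { ((c , c∈ , cb≈y) , k , eq) →
          k , V.respects
                (trans (coordinates-unique b ind {c} {λ i → k *ˢ (1# ∷ v) i}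
                         (≈ᴹ-trans cb≈y (≈ᴹ-trans (≈ᴹ-sym eq) (≈ᴹ-sym (*ₗ-point k v)))) zero)
                       (*-identityʳ k))
                (c∈ zero) , eq })
        where module V = KF.Subspace V

      W-evasive : IsEvasive 𝒜 h W
      W-evasive S (lift (v , S≐)) = h , ℕ.≤-refl , XFₚ.HasDim-≐
        (≐-trans (W∩line v) ((λ (y∈W , y∈) → y∈W , proj₂ S≐ y∈) , (λ (y∈W , y∈) → y∈W , proj₁ S≐ y∈)))
        (HasDim-· V (point≉0 v) dimV)

-- Choice of the subspace `V` of `K` and assembly of the construction.

primePower>1 : ∀ {q} → IsPrimePower q → 1 ℕ.< q
primePower>1 (p , k , p-prime , 1≤k , ≡.refl) =
  -- The bound `1` is read as `p ^ 0`, and `1≤k` as `0 < k`.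
  ℕ.^-monoʳ-< p (ℕ.nonTrivial⇒n>1 p {{prime⇒nonTrivial p-prime}}) 1≤k

proposition3p2 : ∀ {ℓ} (q m n h : ℕ) →
    IsPrimePower q → 1 ≤ m → 2 ≤ n → 1 ≤ h → h ≤ m →
    (F K : HeytingField ℓ ℓ ℓ) →
    HasSize (HeytingField.setoid F) q →
    HasSize (HeytingField.setoid K) (q ^ m) →
    (ι : FieldExtension F K) →
    (X : LeftModule (fieldRing K) ℓ ℓ) →
    Linear.HasDim X U n →
    let open Spreads {F = F} {K = K} ι X in
    ∃[ 𝒜 ]
    IsPartialDesarguesian m 𝒜 ×
    HasSize (elements 𝒜) (q ^ (m * (n ∸ 1))) ×
    (∃[ W ] IsEvasive 𝒜 h W × HasDim ⟪ W ⟫ (m * (n ∸ 1) + h))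
-- From here on `n` stands for the dimension minus one, and `b` is a basis of `X` over `K` whose
-- first vector carries the coordinate restricted to `V`.
proposition3p2 q m (ℕ.suc n) h q-primePower _ _ _ h≤m F K sizeF sizeK ι X (b , isBasis) =
  let 1<q     = primePower>1 q-primePower
      -- Since `h ≤ m` gives `q ^ h ≤ q ^ m`, the field `K` has `h` elements independent over `F`;
      -- their span is `V`.
      e , ind = FiniteSpace.independentFamily {F = F} sizeF (K∣F {F = F} {K} ι) sizeK 1<q h
                  (ℕ.^-monoʳ-≤ q {{ℕ.>-nonZero (ℕ.<⇒≤ 1<q)}} h≤m)
      open LinearProperties (K∣F {F = F} {K} ι) using (span; HasDim-span)
      open DesarguesianSpread {F = F} {K} ι X {q} {m} 1<q sizeF sizeK
      open AffinePoints b (Linear.IsBasis.independent isBasis)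
      V    = span e
      dimV = HasDim-span e ind
  in 𝒜 , partialDesarguesian 𝒜 𝒜⊆desarguesian , 𝒜-size
       , W V dimV , W-evasive V dimV , HasDim-W V dimV
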